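{- For every $d \in \{2,3,4,5,8,11,12,16,24,40\}$, the sequence $\left(\left\lfloor n^{10}/d \right\rfloor\right)_{n \ge 1}$ is eventually prime-free.
   Context: A sequence $(a_n)_{n\ge 1}$ of positive integers is called eventually prime-free if there exists an index $n_0$ such that $a_n$ is composite for all $n \ge n_0$. (Here, as in the paper, this is understood as: only finitely many terms $a_n$ are prime.) -}

module Defs where

open import Data.Nat using (ℕ; _≤_)
open import Data.Nat.Primality using (Prime; Composite; composite⇒¬prime)
open import Data.Product using (∃-syntax; _,_)
open import Relation.Nullary using (¬_)

-- A sequence (a_n)_{n ≥ 1} is given by a function on ℕ whose value at 0 is
-- ignored.  Composite (hence neither 0, 1 nor prime) is required of the tail.
EventuallyPrimeFree : (ℕ → ℕ) → Set
EventuallyPrimeFree a = ∃[ n₀ ] (∀ n → 1 ≤ n → n₀ ≤ n → Composite (a n))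

-- In particular only finitely many terms are prime.
eventuallyPrimeFree⇒finitelyManyPrimes : (a : ℕ → ℕ) → EventuallyPrimeFree a →
  ∃[ n₀ ] (∀ n → 1 ≤ n → n₀ ≤ n → ¬ Prime (a n))
eventuallyPrimeFree⇒finitelyManyPrimes a (n₀ , h) =
  n₀ , λ n 1≤n n₀≤n → composite⇒¬prime (h n 1≤n n₀≤n)

{-# OPTIONS --safe #-}
-- Let r = n¹⁰ mod d.  If r = s² with s < d, then d ⌊n¹⁰/d⌋ = (n⁵ - s)(n⁵ + s) has
-- both factors larger than d once n is large, so ⌊n¹⁰/d⌋ cannot be prime.
-- For the listed d every tenth power has a square residue, except the residue 24
-- modulo 40.  In that case n¹⁰ ≡ 24 even modulo 200, whence 5 ∣ ⌊n¹⁰/40⌋.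
module Submission where

open import Defs
open import Data.Nat using (ℕ; zero; suc; _+_; _*_; _∸_; _^_; _≤_; _<_; NonZero; NonTrivial; nonTrivial⇒nonZero; n>1⇒nonTrivial; >-nonZero)
open import Data.Nat.Properties
open import Data.Nat.DivMod using (_/_; _%_; m≡m%n+[m/n]*n; m%n<n; m%n%n≡m%n; %-distribˡ-*; m∣n⇒o%n%m≡o%m; m%[n*o]/o≡m/o%n; m<n⇒m/n≡0; m*n/n≡m; /-monoˡ-≤)
open import Data.Nat.Divisibility using (_∣_; divides; n∣m*n; ∣⇒≤; m%n≡0⇒n∣m)
open import Data.Nat.Primality using (Prime; Composite; composite; euclidsLemma; prime⇒nonZero; ¬prime⇒composite)
open import Data.Nat.Tactic.RingSolver using (solve-∀)
open import Data.List using (List; []; _∷_)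
open import Data.List.Membership.Propositional using (_∈_)
open import Data.List.Relation.Unary.Any using (here; there)
open import Data.Product using (∃-syntax; _×_; _,_)
open import Data.Sum using (_⊎_; inj₁; inj₂)
open import Relation.Binary.PropositionalEquality using (_≡_; refl; sym; trans; cong; cong₂; subst)
open import Relation.Nullary using (¬_; Dec)
open import Relation.Nullary.Decidable using (True; toWitness; _⊎-dec_)

^-%-distrib : ∀ n k m .{{_ : NonZero m}} → n ^ k % m ≡ (n % m) ^ k % m
^-%-distrib n zero    m = refl
^-%-distrib n (suc k) m = begin-equality
  n * n ^ k % m                             ≡⟨ %-distribˡ-* n (n ^ k) m ⟩
  -- The doubled reduction `n % m % m` gives the product the shape in which `%-distribˡ-*` can be
  -- read backwards.
  (n % m) * (n ^ k % m) % m                 ≡⟨ cong₂ (λ x y → x * y % m) (sym (m%n%n≡m%n n m)) (^-%-distrib n k m) ⟩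
  (n % m % m) * ((n % m) ^ k % m) % m       ≡⟨ sym (%-distribˡ-* (n % m) ((n % m) ^ k) m) ⟩
  (n % m) * (n % m) ^ k % m                 ∎
  where open ≤-Reasoning

m≤m^[1+n] : ∀ m n .{{_ : NonZero m}} → m ≤ m ^ suc n
m≤m^[1+n] m n = m≤m*n m (m ^ n) {{m^n≢0 m n}}

-- Writing `a` as `k * q` and cancelling `q` leaves `d ≡ k * b`, so `b` divides the nonzero `d`.
prime-factor⇒cofactor≤ : ∀ {a b d q} .{{_ : NonZero d}} →
  Prime q → d * q ≡ a * b → q ∣ a → b ≤ d
prime-factor⇒cofactor≤ {a} {b} {d} {q} pq dq≡ab (divides k a≡kq) =
  ∣⇒≤ (divides k (*-cancelʳ-≡ d (k * b) q {{prime⇒nonZero pq}} (begin-equality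
    d * q        ≡⟨ dq≡ab ⟩
    a * b        ≡⟨ cong (_* b) a≡kq ⟩
    k * q * b    ≡⟨ swap k q b ⟩
    k * b * q    ∎)))
  where
  open ≤-Reasoning
  swap : ∀ x y z → x * y * z ≡ x * z * y
  swap = solve-∀

-- By Euclid's lemma a prime `q` would divide `a` or `b`, and the other factor would then be at most
-- `d`. The size of `a * b` also excludes `q ≤ 1`, so that not prime means composite.
large-factors⇒composite : ∀ {a b d q} .{{_ : NonZero d}} →
  d * q ≡ a * b → d < a → d < b → Composite q
large-factors⇒composite {a} {b} {d} {q} dq≡ab d<a d<b =
  ¬prime⇒composite {{n>1⇒nonTrivial 1<q}} ¬prime
  where
  open ≤-Reasoning
  instance
    b≢0 : NonZero b
    b≢0 = >-nonZero (m<n⇒0<n d<b)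

  1<q : 1 < q
  1<q = *-cancelˡ-< d 1 q (begin-strict
    d * 1   ≡⟨ *-identityʳ d ⟩
    d       <⟨ d<a ⟩
    a       ≤⟨ m≤m*n a b ⟩
    a * b   ≡⟨ dq≡ab ⟨
    d * q   ∎)

  ¬prime : ¬ Prime q
  ¬prime pq with euclidsLemma a b pq (subst (q ∣_) dq≡ab (n∣m*n d))
  ... | inj₁ q∣a = <⇒≱ d<b (prime-factor⇒cofactor≤ pq dq≡ab q∣a)
  ... | inj₂ q∣b = <⇒≱ d<a (prime-factor⇒cofactor≤ pq (trans dq≡ab (*-comm a b)) q∣b)

square-residue⇒composite : ∀ {m s} d .{{_ : NonZero d}} →
  m * m % d ≡ s * s → s + d < m → Composite (m * m / d)
square-residue⇒composite {m} {s} d m²%d≡s² s+d<m =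
  large-factors⇒composite dq≡[m∸s][m+s] d<m∸s d<m+s
  where
  open ≤-Reasoning
  d<m∸s : d < m ∸ s
  d<m∸s = m+n≤o⇒m≤o∸n (suc d) (subst (_≤ m) (cong suc (+-comm s d)) s+d<m)

  d<m+s : d < m + s
  d<m+s = ≤-trans (≤-<-trans (m≤n+m d s) s+d<m) (m≤m+n m s)

  difference-of-squares : ∀ x y → (x + y) * (x + y) ≡ y * y + x * (x + y + y)
  difference-of-squares = solve-∀

  m∸s+s≡m : m ∸ s + s ≡ m
  m∸s+s≡m = m∸n+n≡m (≤-trans (m≤m+n s d) (<⇒≤ s+d<m))

  dq≡[m∸s][m+s] : d * (m * m / d) ≡ (m ∸ s) * (m + s)
  -- Adding `s * s` to both sides keeps truncated subtraction out of the ring identity, which is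
  -- applied with `x = m ∸ s` and `y = s`.
  dq≡[m∸s][m+s] = +-cancelˡ-≡ (s * s) _ _ (begin-equality
    s * s + d * (m * m / d)                   ≡⟨ cong₂ _+_ (sym m²%d≡s²) (*-comm d _) ⟩
    m * m % d + (m * m / d) * d               ≡⟨ m≡m%n+[m/n]*n (m * m) d ⟨
    m * m                                     ≡⟨ cong (λ x → x * x) m∸s+s≡m ⟨
    (m ∸ s + s) * (m ∸ s + s)                 ≡⟨ difference-of-squares (m ∸ s) s ⟩
    s * s + (m ∸ s) * (m ∸ s + s + s)         ≡⟨ cong (λ x → s * s + (m ∸ s) * (x + s)) m∸s+s≡m ⟩
    s * s + (m ∸ s) * (m + s)                 ∎)

-- Reducing `m / d` modulo `p` amounts to dividing `m % (p * d)` by `d`, which gives 0 here. The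
-- lower bound on `m` makes `p` a proper divisor.
small-residue⇒composite : ∀ {m} p d .{{_ : NonTrivial p}} .{{d≢0 : NonZero d}} .{{_ : NonZero (p * d)}} →
  m % (p * d) < d → suc p * d ≤ m → Composite (m / d)
small-residue⇒composite {m} p d {{d≢0 = d≢0}} r<d [1+p]d≤m = composite p<q p∣q
  where
  open ≤-Reasoning
  instance
    p≢0 : NonZero p
    p≢0 = nonTrivial⇒nonZero p

  p<q : p < m / d
  p<q = begin
    suc p            ≡⟨ m*n/n≡m (suc p) d ⟨
    suc p * d / d    ≤⟨ /-monoˡ-≤ d [1+p]d≤m ⟩
    m / d            ∎

  p∣q : p ∣ m / d
  p∣q = m%n≡0⇒n∣m (m / d) p (begin-equality
    m / d % p          ≡⟨ m%[n*o]/o≡m/o%n m p d {{p≢0}} {{d≢0}} {{m*n≢0 p d}} ⟨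
    m % (p * d) / d    ≡⟨ m<n⇒m/n≡0 r<d ⟩
    0                  ∎)

-- Meant for a residue `r` modulo `p * d`: the first alternative sees it only modulo `d`, the second
-- uses all of it. The bound `s < d` makes the search for a root finite.
SquareOrSmall : (d : ℕ) .{{_ : NonZero d}} → ℕ → Set
SquareOrSmall d r = (∃[ s ] s < d × r % d ≡ s * s) ⊎ r < d

-- The exponent `k + k` exhibits each power as the square of `a ^ k`, and it computes to 10 at
-- `k = 5`.
AllPowersSquareOrSmall : (p k d : ℕ) .{{_ : NonZero d}} .{{_ : NonZero (p * d)}} → Set
AllPowersSquareOrSmall p k d = ∀ {a} → a < p * d → SquareOrSmall d (a ^ (k + k) % (p * d))

allPowersSquareOrSmall? : ∀ p k d .{{_ : NonZero d}} .{{_ : NonZero (p * d)}} →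
  Dec (AllPowersSquareOrSmall p k d)
allPowersSquareOrSmall? p k d = allUpTo? (λ a → squareOrSmall? (a ^ (k + k) % (p * d))) (p * d)
  where
  squareOrSmall? : ∀ r → Dec (SquareOrSmall d r)
  squareOrSmall? r = anyUpTo? (λ s → r % d ≟ s * s) d ⊎-dec (r <? d)

squareOrSmall⇒composite : ∀ p k d n .{{_ : NonTrivial p}} .{{_ : NonZero k}} .{{_ : NonZero d}} .{{_ : NonZero (p * d)}} →
  .{{n≢0 : NonZero n}} → suc p * d ≤ n →
  SquareOrSmall d (n ^ (k + k) % (p * d)) → Composite (n ^ (k + k) / d)
squareOrSmall⇒composite p k@(suc k-1) d n [1+p]d≤n (inj₂ r<d) =
  small-residue⇒composite p d r<d (≤-trans [1+p]d≤n (m≤m^[1+n] n (k-1 + k)))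
squareOrSmall⇒composite p k@(suc k-1) d n [1+p]d≤n (inj₁ (s , s<d , r%d≡s²)) =
  subst (λ x → Composite (x / d)) (sym n²ᵏ≡nᵏnᵏ)
    (square-residue⇒composite d nᵏnᵏ%d≡s² s+d<nᵏ)
  where
  open ≤-Reasoning
  n²ᵏ≡nᵏnᵏ : n ^ (k + k) ≡ n ^ k * n ^ k
  n²ᵏ≡nᵏnᵏ = ^-distribˡ-+-* n k k

  nᵏnᵏ%d≡s² : n ^ k * n ^ k % d ≡ s * s
  nᵏnᵏ%d≡s² = begin-equality
    n ^ k * n ^ k % d             ≡⟨ cong (_% d) n²ᵏ≡nᵏnᵏ ⟨
    n ^ (k + k) % d               ≡⟨ m∣n⇒o%n%m≡o%m d (p * d) (n ^ (k + k)) (n∣m*n p) ⟨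
    n ^ (k + k) % (p * d) % d     ≡⟨ r%d≡s² ⟩
    s * s                         ∎

  s+d<nᵏ : s + d < n ^ k
  -- The threshold of the small-residue case suffices here too: `suc p * d` unfolds to `d + p * d`,
  -- which is at least `d + d`.
  s+d<nᵏ = begin-strict
    s + d        <⟨ +-monoˡ-< d s<d ⟩
    d + d        ≤⟨ +-monoʳ-≤ d (m≤n*m d p {{nonTrivial⇒nonZero p}}) ⟩
    suc p * d    ≤⟨ [1+p]d≤n ⟩
    n            ≤⟨ m≤m^[1+n] n k-1 ⟩
    n ^ k        ∎

residues⇒primeFree : ∀ p k d .{{_ : NonTrivial p}} .{{_ : NonZero k}} .{{_ : NonZero d}} .{{_ : NonZero (p * d)}} →
  AllPowersSquareOrSmall p k d → EventuallyPrimeFree (λ n → n ^ (k + k) / d)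
residues⇒primeFree p k d residues = suc p * d , λ n 1≤n [1+p]d≤n →
  squareOrSmall⇒composite p k d n {{n≢0 = >-nonZero 1≤n}} [1+p]d≤n
    (subst (SquareOrSmall d) (sym (^-%-distrib n (k + k) (p * d))) (residues (m%n<n n (p * d))))

primeFree : ∀ d .{{_ : NonZero d}} .{{_ : NonZero (5 * d)}} →
  {_ : True (allPowersSquareOrSmall? 5 5 d)} → EventuallyPrimeFree (λ n → n ^ 10 / d)
-- The first 5 is the divisor `p`, the second half the exponent. Tenth powers prime to 5 are 1 or -1
-- modulo 25, which is why 24 modulo 40 lifts to 24 modulo 200. For concrete `d` the residue check
-- is settled by evaluation.
primeFree d {checked} = residues⇒primeFree 5 5 d (toWitness checked)

theorem7 : (d : ℕ) .{{_ : NonZero d}} →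
    d ∈ (2 ∷ 3 ∷ 4 ∷ 5 ∷ 8 ∷ 11 ∷ 12 ∷ 16 ∷ 24 ∷ 40 ∷ []) →
    EventuallyPrimeFree (λ n → n ^ 10 / d)
theorem7 _ (here refl) = primeFree 2
theorem7 _ (there (here refl)) = primeFree 3
theorem7 _ (there (there (here refl))) = primeFree 4
theorem7 _ (there (there (there (here refl)))) = primeFree 5
theorem7 _ (there (there (there (there (here refl))))) = primeFree 8
theorem7 _ (there (there (there (there (there (here refl)))))) = primeFree 11
theorem7 _ (there (there (there (there (there (there (here refl))))))) = primeFree 12
theorem7 _ (there (there (there (there (there (there (there (here refl)))))))) = primeFree 16
theorem7 _ (there (there (there (there (there (there (there (there (here refl))))))))) = primeFree 24
theorem7 _ (there (there (there (there (there (there (there (there (there (here refl)))))))))) = primeFree 40
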